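{- Call an even self-dual $L$-code of length $n$ extremal if its minimal Euclidean weight equals $2\lfloor n/3\rfloor+2$. Extremal even self-dual $L$-codes of length $n$ exist for $n\in\{1,2,3,4,5,6,7,8,10,11\}$, and they do not exist for any length $n\geq 1$ with $n\notin\{1,2,3,4,5,6,7,8,10,11,14\}$ (the case $n=14$ is left open).
   Context: Let $L=\{0,1,\omega,\bar\omega\}$ be the Klein four-group $\mathbf{Z}_2\times\mathbf{Z}_2$. Define $|0|^2=0$, $|1|^2=1$, $|\omega|^2=|\bar\omega|^2=2$ and $q(x)=|x|^2\bmod 2$; the dot product on $L$ is $x\cdot y=q(x+y)-q(x)-q(y)\in\mathbf{F}_2$ (so $x\cdot y=1$ iff $x,y$ are distinct and nonzero). On $L^n$: scalar product $(\mathbf{x},\mathbf{y})=\sum_i x_i\cdot y_i$, Euclidean weight $\mathrm{ewt}(\mathbf{x})=\sum_i |x_i|^2$. An $L$-code of length $n$ is a subgroup $C\subseteq L^n$; $C^\perp=\{\mathbf{x}:(\mathbf{x},\mathbf{y})=0\ \forall\mathbf{y}\in C\}$; $C$ is self-dual if $C=C^\perp$, even if all codewords have even Euclidean weight. The minimal Euclidean weight of $C$ is $\min\{\mathrm{ewt}(\mathbf{x}):\mathbf{x}\in C\setminus\{0\}\}$. -}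

module Defs where

open import Data.Bool using (Bool; true; false; _xor_)
open import Data.Nat using (ℕ; _+_; _*_; _≤_; _%_; _/_)
open import Data.Nat.Divisibility using (_∣_)
open import Data.Vec using (Vec; []; _∷_; zipWith; replicate; foldr)
open import Data.Product using (Σ; _×_; ∃)
open import Relation.Binary.PropositionalEquality using (_≡_; _≢_)
open import Function.Bundles using (_⇔_)

data L : Set where
  0L 1L ω ω̄ : L

_+L_ : L → L → L
0L +L y  = y
x  +L 0L = x
1L +L 1L = 0L
1L +L ω  = ω̄
1L +L ω̄  = ω
ω  +L 1L = ω̄
ω  +L ω  = 0L
ω  +L ω̄  = 1L
ω̄  +L 1L = ω
ω̄  +L ω  = 1L
ω̄  +L ω̄  = 0L

norm² : L → ℕ
norm² 0L = 0
norm² 1L = 1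
norm² ω  = 2
norm² ω̄  = 2

-- q(x) = |x|^2 mod 2, valued in F2 = Bool (false = 0, true = 1)
q : L → Bool
q 0L = false
q 1L = true
q ω  = false
q ω̄  = false

_·L_ : L → L → Bool
x ·L y = (q (x +L y) xor q x) xor q y

Word : ℕ → Set
Word n = Vec L n

_⊕_ : ∀ {n} → Word n → Word n → Word n
_⊕_ = zipWith _+L_

zeroW : ∀ {n} → Word n
zeroW = replicate _ 0L

⟨_,_⟩ : ∀ {n} → Word n → Word n → Bool
⟨ x , y ⟩ = foldr _ _xor_ false (zipWith _·L_ x y)

ewt : ∀ {n} → Word n → ℕ
ewt x = foldr _ _+_ 0 (Data.Vec.map norm² x)
  where import Data.Vec

-- An L-code of length n: a subgroup of L^n, given by its (decidable)
-- membership predicate.  Since every element of L^n is its own inverse,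
-- containing 0 and closure under addition is exactly being a subgroup.
record LCode (n : ℕ) : Set where
  field
    mem     : Word n → Bool
    mem-0   : mem zeroW ≡ true
    mem-⊕   : ∀ x y → mem x ≡ true → mem y ≡ true → mem (x ⊕ y) ≡ true
open LCode public

_∈C_ : ∀ {n} → Word n → LCode n → Set
x ∈C C = mem C x ≡ true

_∈⊥_ : ∀ {n} → Word n → LCode n → Set
x ∈⊥ C = ∀ y → y ∈C C → ⟨ x , y ⟩ ≡ false

SelfDual : ∀ {n} → LCode n → Set
SelfDual C = ∀ x → (x ∈C C) ⇔ (x ∈⊥ C)

Even : ∀ {n} → LCode n → Set
Even C = ∀ x → x ∈C C → 2 ∣ ewt x

MinEwt : ∀ {n} → LCode n → ℕ → Set
MinEwt C d =
  (∃ λ x → x ∈C C × x ≢ zeroW × ewt x ≡ d) ×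
  (∀ x → x ∈C C → x ≢ zeroW → d ≤ ewt x)

Extremal : ∀ {n} → LCode n → Set
Extremal {n} C = Even C × SelfDual C × MinEwt C (2 * (n / 3) + 2)

{-# OPTIONS --safe #-}
module Submission where

-- Existence: for n = 6 and n = 10 the code comes from the two-graph of a Paley
-- graph with an added isolated point, otherwise from a graph on n vertices, with
-- one generator per vertex (ω there and 1 at the neighbours).  A code is given by
-- a symplectic basis (hᵢ, gᵢ) of L^n; then x = Σ ⟨x,gᵢ⟩hᵢ + ⟨x,hᵢ⟩gᵢ shows that
-- the span of the hᵢ is self-dual, and the weights are checked by enumeration.
--
-- Nonexistence: let d be the minimal weight and K a set of three coordinates.
-- By duality a self-dual code contains independent words a, b, c whose
-- coordinates outside K lie in {0,1}.  The seven nonzero combinations have total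
-- weight at most 4 per coordinate outside K and 10 per coordinate in K, so
-- 7d ≤ 4n + 18.  This is improved by using a word x with at most one coordinate
-- outside {0,1}.  Taking a = x bounds ewt x by 4n + 18 - 6d ≤ n - 3, so x has
-- three zeros.  If x is binary, take K to be two of its zeros and c = x.
-- Otherwise take K to be three zeros; orthogonality to x then makes a, b, c
-- vanish at the coordinate where x is not binary.  Either way 7d ≤ 4n + 14,
-- which is false for d = 2⌊n/3⌋ + 2 with the lengths in question.

open import Defs
open import Data.Bool using (Bool; true; false; not; _∧_; _xor_; if_then_else_)
open import Data.Bool.ListAction using (any)
import Data.Bool.Properties as Bool
open import Data.Empty using (⊥)
open import Data.Fin using (Fin; zero; suc; toℕ)
import Data.Fin.Properties as Fin
open import Data.List using (List; _∷_; []; tabulate; length)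
open import Data.List.Membership.DecPropositional using (_∈?_)
open import Data.List.Membership.Propositional using (_∈_; _∉_)
open import Data.List.Relation.Unary.All as All using (All; []; _∷_)
open import Data.List.Relation.Unary.Any using (here; there)
open import Data.Nat using (ℕ; zero; suc; _+_; _*_; _∸_; _≤_; _<_; _≥_; _/_; _%_; _≡ᵇ_; ∣_-_∣; z≤n; s≤s)
open import Data.Nat.DivMod using (m≡m%n+[m/n]*n; m%n<n; /-monoˡ-≤)
open import Data.Nat.Divisibility using (_∣_; _∣?_)
import Data.Nat.Properties as ℕ
open import Data.Nat.Tactic.RingSolver using (solve-∀)
open import Data.Product using (_×_; ∃; _,_; proj₁; proj₂)
open import Data.Sum using (_⊎_; inj₁; inj₂)
open import Data.Unit using (tt)
open import Data.Vec as Vec using ([]; _∷_; _[_]≔_; lookup)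
open import Data.Vec.Properties using (≡-dec; lookup-zipWith; lookup-replicate; lookup∘update; lookup∘update′)
open import Function using (_∘_; mk⇔)
open import Function.Bundles using (module Equivalence)
open import Relation.Binary.PropositionalEquality
open import Relation.Nullary using (¬_; Dec; yes; no; does; contradiction)
open import Relation.Nullary.Decidable using (True; toWitness; map′; _×-dec_; _⊎-dec_; _→-dec_; ¬?)
open import Algebra.Properties.CommutativeMonoid.Sum ℕ.+-0-commutativeMonoid using (sum; ∑-distrib-+; sum-replicate-zero)
open import Algebra.Properties.CommutativeSemigroup ℕ.+-commutativeSemigroup using (interchange)

-- The four-group and its pairing, by exhaustive decision.

all-L? : {P : L → Set} → (∀ a → Dec (P a)) → Dec (∀ a → P a)
all-L? P? = map′ (λ { (p , _) 0L → p ; (_ , p , _) 1L → p ; (_ , _ , p , _) ω → p ; (_ , _ , _ , p) ω̄ → p })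
                 (λ p → p 0L , p 1L , p ω , p ω̄)
                 (P? 0L ×-dec P? 1L ×-dec P? ω ×-dec P? ω̄)

_≟L_ : (a b : L) → Dec (a ≡ b)
0L ≟L 0L = yes refl
0L ≟L 1L = no λ ()
0L ≟L ω  = no λ ()
0L ≟L ω̄  = no λ ()
1L ≟L 0L = no λ ()
1L ≟L 1L = yes refl
1L ≟L ω  = no λ ()
1L ≟L ω̄  = no λ ()
ω  ≟L 0L = no λ ()
ω  ≟L 1L = no λ ()
ω  ≟L ω  = yes refl
ω  ≟L ω̄  = no λ ()
ω̄  ≟L 0L = no λ ()
ω̄  ≟L 1L = no λ ()
ω̄  ≟L ω  = no λ ()
ω̄  ≟L ω̄  = yes refl

_≟W_ : ∀ {n} (x y : Word n) → Dec (x ≡ y)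
_≟W_ = ≡-dec _≟L_

+L-comm : ∀ a b → a +L b ≡ b +L a
+L-comm = toWitness {a? = all-L? λ a → all-L? λ b → _ ≟L _} tt

+L-assoc : ∀ a b c → (a +L b) +L c ≡ a +L (b +L c)
+L-assoc = toWitness {a? = all-L? λ a → all-L? λ b → all-L? λ c → _ ≟L _} tt

+L-identityʳ : ∀ a → a +L 0L ≡ a
+L-identityʳ = toWitness {a? = all-L? λ a → _ ≟L _} tt

+L-self : ∀ a → a +L a ≡ 0L
+L-self = toWitness {a? = all-L? λ a → _ ≟L _} tt

·L-comm : ∀ a b → a ·L b ≡ b ·L a
·L-comm = toWitness {a? = all-L? λ a → all-L? λ b → _ Bool.≟ _} tt

·L-distribʳ : ∀ a b c → (a +L b) ·L c ≡ (a ·L c) xor (b ·L c)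
·L-distribʳ = toWitness {a? = all-L? λ a → all-L? λ b → all-L? λ c → _ Bool.≟ _} tt

xor-medial : ∀ a b c d → (a xor b) xor (c xor d) ≡ (a xor c) xor (b xor d)
xor-medial false b false d = refl
xor-medial false false true d = refl
xor-medial false true true d = refl
xor-medial true false false d = refl
xor-medial true true false d = sym (Bool.not-involutive d)
xor-medial true false true d = Bool.not-involutive d
xor-medial true true true d = refl

-- Addition of words and bilinearity of the scalar product.

⊕-comm : ∀ {n} (x y : Word n) → x ⊕ y ≡ y ⊕ x
⊕-comm []       []       = refl
⊕-comm (a ∷ x) (b ∷ y) = cong₂ _∷_ (+L-comm a b) (⊕-comm x y)

⊕-assoc : ∀ {n} (x y z : Word n) → (x ⊕ y) ⊕ z ≡ x ⊕ (y ⊕ z)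
⊕-assoc []       []       []       = refl
⊕-assoc (a ∷ x) (b ∷ y) (c ∷ z) = cong₂ _∷_ (+L-assoc a b c) (⊕-assoc x y z)

⊕-identityˡ : ∀ {n} (x : Word n) → zeroW ⊕ x ≡ x
⊕-identityˡ []       = refl
⊕-identityˡ (a ∷ x) = cong (a ∷_) (⊕-identityˡ x)

⊕-identityʳ : ∀ {n} (x : Word n) → x ⊕ zeroW ≡ x
⊕-identityʳ x = trans (⊕-comm x zeroW) (⊕-identityˡ x)

⊕-self : ∀ {n} (x : Word n) → x ⊕ x ≡ zeroW
⊕-self []       = refl
⊕-self (a ∷ x) = cong₂ _∷_ (+L-self a) (⊕-self x)

⊕-medial : ∀ {n} (x y z w : Word n) → (x ⊕ y) ⊕ (z ⊕ w) ≡ (x ⊕ z) ⊕ (y ⊕ w)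
⊕-medial x y z w = begin
  (x ⊕ y) ⊕ (z ⊕ w) ≡⟨ ⊕-assoc x y (z ⊕ w) ⟩
  x ⊕ (y ⊕ (z ⊕ w)) ≡⟨ cong (x ⊕_) (⊕-assoc y z w) ⟨
  x ⊕ ((y ⊕ z) ⊕ w) ≡⟨ cong (λ u → x ⊕ (u ⊕ w)) (⊕-comm y z) ⟩
  x ⊕ ((z ⊕ y) ⊕ w) ≡⟨ cong (x ⊕_) (⊕-assoc z y w) ⟩
  x ⊕ (z ⊕ (y ⊕ w)) ≡⟨ ⊕-assoc x z (y ⊕ w) ⟨
  (x ⊕ z) ⊕ (y ⊕ w) ∎
  where open ≡-Reasoning

⟨⟩-comm : ∀ {n} (x y : Word n) → ⟨ x , y ⟩ ≡ ⟨ y , x ⟩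
⟨⟩-comm []       []       = refl
⟨⟩-comm (a ∷ x) (b ∷ y) = cong₂ _xor_ (·L-comm a b) (⟨⟩-comm x y)

⟨⟩-distribʳ : ∀ {n} (x y z : Word n) → ⟨ x ⊕ y , z ⟩ ≡ ⟨ x , z ⟩ xor ⟨ y , z ⟩
⟨⟩-distribʳ []       []       []       = refl
⟨⟩-distribʳ (a ∷ x) (b ∷ y) (c ∷ z) =
  trans (cong₂ _xor_ (·L-distribʳ a b c) (⟨⟩-distribʳ x y z))
        (xor-medial (a ·L c) (b ·L c) ⟨ x , z ⟩ ⟨ y , z ⟩)

⟨⟩-zeroˡ : ∀ {n} (x : Word n) → ⟨ zeroW , x ⟩ ≡ false
⟨⟩-zeroˡ []        = refl
⟨⟩-zeroˡ (0L ∷ x) = ⟨⟩-zeroˡ x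
⟨⟩-zeroˡ (1L ∷ x) = ⟨⟩-zeroˡ x
⟨⟩-zeroˡ (ω ∷ x)  = ⟨⟩-zeroˡ x
⟨⟩-zeroˡ (ω̄ ∷ x)  = ⟨⟩-zeroˡ x

ewt-zeroW : ∀ n → ewt (zeroW {n}) ≡ 0
ewt-zeroW zero    = refl
ewt-zeroW (suc n) = ewt-zeroW n

ewt≡0⇒zeroW : ∀ {n} (x : Word n) → ewt x ≡ 0 → x ≡ zeroW
ewt≡0⇒zeroW []       _ = refl
ewt≡0⇒zeroW (0L ∷ x) e = cong (0L ∷_) (ewt≡0⇒zeroW x e)

-- Codes given by a symplectic basis of L^n

_•_ : ∀ {n} → Bool → Word n → Word n
b • x = if b then x else zeroW

•-distribˡ : ∀ {n} b c (x : Word n) → (b xor c) • x ≡ (b • x) ⊕ (c • x)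
•-distribˡ false c     x = sym (⊕-identityˡ (c • x))
•-distribˡ true  false x = sym (⊕-identityʳ x)
•-distribˡ true  true  x = sym (⊕-self x)

Additive : ∀ {m n} → (Word m → Word n) → Set
Additive f = ∀ x y → f (x ⊕ y) ≡ f x ⊕ f y

single : ∀ {n} → Fin n → L → Word n
single i a = zeroW [ i ]≔ a

additive-zero : ∀ {m n} (f : Word m → Word n) → Additive f → f zeroW ≡ zeroW
additive-zero f f-⊕ = begin
  f zeroW                       ≡⟨ ⊕-identityˡ (f zeroW) ⟨
  zeroW ⊕ f zeroW               ≡⟨ cong (_⊕ f zeroW) (⊕-self (f zeroW)) ⟨
  (f zeroW ⊕ f zeroW) ⊕ f zeroW ≡⟨ ⊕-assoc (f zeroW) (f zeroW) (f zeroW) ⟩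
  f zeroW ⊕ (f zeroW ⊕ f zeroW) ≡⟨ cong (f zeroW ⊕_) (trans (cong f (sym (⊕-self zeroW))) (f-⊕ zeroW zeroW)) ⟨
  f zeroW ⊕ f zeroW             ≡⟨ ⊕-self (f zeroW) ⟩
  zeroW                         ∎
  where open ≡-Reasoning

-- Words supported on one coordinate generate `L^n`; splitting off the head gives an induction on
-- the length. This reduces `expand hg x ≡ x` to finitely many checks.
additive-ext : ∀ {m n} (f g : Word m → Word n) → Additive f → Additive g →
               (∀ i a → f (single i a) ≡ g (single i a)) → ∀ x → f x ≡ g x
additive-ext f g f-⊕ g-⊕ eq []      = trans (additive-zero f f-⊕) (sym (additive-zero g g-⊕))
additive-ext f g f-⊕ g-⊕ eq (a ∷ x) = begin
  f (a ∷ x)                      ≡⟨ cong f split ⟩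
  f (single zero a ⊕ (0L ∷ x))   ≡⟨ f-⊕ (single zero a) (0L ∷ x) ⟩
  f (single zero a) ⊕ f (0L ∷ x) ≡⟨ cong₂ _⊕_ (eq zero a) tails ⟩
  g (single zero a) ⊕ g (0L ∷ x) ≡⟨ g-⊕ (single zero a) (0L ∷ x) ⟨
  g (single zero a ⊕ (0L ∷ x))   ≡⟨ cong g split ⟨
  g (a ∷ x)                      ∎
  where
  open ≡-Reasoning
  split : a ∷ x ≡ single zero a ⊕ (0L ∷ x)
  split = cong₂ _∷_ (sym (+L-identityʳ a)) (sym (⊕-identityˡ x))
  tails : f (0L ∷ x) ≡ g (0L ∷ x)
  tails = additive-ext (f ∘ (0L ∷_)) (g ∘ (0L ∷_)) (λ y z → f-⊕ (0L ∷ y) (0L ∷ z))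
                       (λ y z → g-⊕ (0L ∷ y) (0L ∷ z)) (eq ∘ suc) x

-- A list of pairs (h , g); the code is generated by the h, and the g
-- are to satisfy ⟨ hᵢ , gⱼ ⟩ = δᵢⱼ and ⟨ gᵢ , gⱼ ⟩ = 0.
Frame : ℕ → Set
Frame n = List (Word n × Word n)

module _ {n : ℕ} where

  expand : Frame n → Word n → Word n
  expand []             x = zeroW
  expand ((h , g) ∷ hg) x = ((⟨ x , g ⟩ • h) ⊕ (⟨ x , h ⟩ • g)) ⊕ expand hg x

  expand-additive : ∀ hg → Additive (expand hg)
  expand-additive []             x y = sym (⊕-identityˡ zeroW)
  expand-additive ((h , g) ∷ hg) x y = begin
    ((⟨ x ⊕ y , g ⟩ • h) ⊕ (⟨ x ⊕ y , h ⟩ • g)) ⊕ expand hg (x ⊕ y)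
      ≡⟨ cong₂ _⊕_ (cong₂ _⊕_ (lin g h) (lin h g)) (expand-additive hg x y) ⟩
    (((⟨ x , g ⟩ • h) ⊕ (⟨ y , g ⟩ • h)) ⊕ ((⟨ x , h ⟩ • g) ⊕ (⟨ y , h ⟩ • g))) ⊕ (expand hg x ⊕ expand hg y)
      ≡⟨ cong (_⊕ (expand hg x ⊕ expand hg y)) (⊕-medial _ _ _ _) ⟩
    (((⟨ x , g ⟩ • h) ⊕ (⟨ x , h ⟩ • g)) ⊕ ((⟨ y , g ⟩ • h) ⊕ (⟨ y , h ⟩ • g))) ⊕ (expand hg x ⊕ expand hg y)
      ≡⟨ ⊕-medial _ _ _ _ ⟩
    expand ((h , g) ∷ hg) x ⊕ expand ((h , g) ∷ hg) y ∎
    where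
    open ≡-Reasoning
    lin : ∀ u v → ⟨ x ⊕ y , u ⟩ • v ≡ (⟨ x , u ⟩ • v) ⊕ (⟨ y , u ⟩ • v)
    lin u v = trans (cong (_• v) (⟨⟩-distribʳ x y u)) (•-distribˡ ⟨ x , u ⟩ ⟨ y , u ⟩ v)

  -- Codes are defined by orthogonality to the `h` rather than as their span: this is Boolean and
  -- additive at once, and `expand` recovers the span description.
  orthogonal : Frame n → Word n → Bool
  orthogonal []             x = true
  orthogonal ((h , _) ∷ hg) x = not ⟨ x , h ⟩ ∧ orthogonal hg x

  orthogonal-zeroW : ∀ hg → orthogonal hg zeroW ≡ true
  orthogonal-zeroW []             = refl
  orthogonal-zeroW ((h , _) ∷ hg) rewrite ⟨⟩-zeroˡ h = orthogonal-zeroW hg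

  orthogonal-⊕ : ∀ hg x y → orthogonal hg x ≡ true → orthogonal hg y ≡ true → orthogonal hg (x ⊕ y) ≡ true
  orthogonal-⊕ []             x y _  _  = refl
  orthogonal-⊕ ((h , _) ∷ hg) x y ox oy rewrite ⟨⟩-distribʳ x y h
    with ⟨ x , h ⟩ | ⟨ y , h ⟩
  ... | false | false = orthogonal-⊕ hg x y ox oy

  code : Frame n → LCode n
  code hg = record { mem = orthogonal hg ; mem-0 = orthogonal-zeroW hg ; mem-⊕ = orthogonal-⊕ hg }

  -- Evaluates `p` on the coset of `x` by the span of the `h`, one doubling per generator.
  onSpan : (Word n → Bool) → Frame n → Word n → Bool
  onSpan p []             x = p x
  onSpan p ((h , _) ∷ hg) x = onSpan p hg x ∧ onSpan p hg (x ⊕ h)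

  -- Orthogonality of `x` to the `h` removes every `g` from its expansion, so `expand hg x` is one
  -- of the enumerated sums; `⟨ x , g ⟩` tells which branch to follow.
  onSpan-expand : ∀ p hg x y → orthogonal hg x ≡ true → onSpan p hg y ≡ true → p (y ⊕ expand hg x) ≡ true
  onSpan-expand p []             x y _  e = trans (cong p (⊕-identityʳ y)) e
  onSpan-expand p ((h , g) ∷ hg) x y ox e
    with ⟨ x , h ⟩ | ⟨ x , g ⟩ | onSpan p hg y in e₀ | onSpan p hg (y ⊕ h) in e₁
  ... | false | false | true | true =
    trans (cong (λ u → p (y ⊕ u)) (trans (cong (_⊕ expand hg x) (⊕-identityˡ zeroW)) (⊕-identityˡ (expand hg x))))
          (onSpan-expand p hg x y ox e₀)
  ... | false | true  | true | true =
    trans (cong p (trans (cong (λ u → y ⊕ (u ⊕ expand hg x)) (⊕-identityʳ h)) (sym (⊕-assoc y h (expand hg x)))))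
          (onSpan-expand p hg x (y ⊕ h) ox e₁)

  expand-orthogonal : ∀ hg x y → orthogonal hg x ≡ true → orthogonal hg y ≡ true → ⟨ expand hg x , y ⟩ ≡ false
  expand-orthogonal []             x y _  _  = ⟨⟩-zeroˡ y
  expand-orthogonal ((h , g) ∷ hg) x y ox oy
    with ⟨ x , h ⟩ | ⟨ y , h ⟩ in yh
  ... | false | false = trans (⟨⟩-distribʳ ((⟨ x , g ⟩ • h) ⊕ zeroW) (expand hg x) y) (cong₂ _xor_ lead (expand-orthogonal hg x y ox oy))
    where
    lead : ⟨ (⟨ x , g ⟩ • h) ⊕ zeroW , y ⟩ ≡ false
    lead = trans (cong (λ u → ⟨ u , y ⟩) (⊕-identityʳ (⟨ x , g ⟩ • h))) (scaled ⟨ x , g ⟩)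
      where
      scaled : ∀ b → ⟨ b • h , y ⟩ ≡ false
      scaled false = ⟨⟩-zeroˡ y
      scaled true  = trans (⟨⟩-comm h y) yh

  -- Each generator lies in the code, so a dual word is orthogonal to it. The list `hg′` is consumed
  -- while the frame `hg` defining the code stays fixed.
  ∈⊥⇒orthogonal : ∀ hg x → (∀ y → y ∈C code hg → ⟨ x , y ⟩ ≡ false) →
                  ∀ hg′ → All (λ p → orthogonal hg (proj₁ p) ≡ true) hg′ → orthogonal hg′ x ≡ true
  ∈⊥⇒orthogonal hg x x⊥ []              []       = refl
  ∈⊥⇒orthogonal hg x x⊥ ((h , _) ∷ hg′) (o ∷ os) rewrite x⊥ h o = ∈⊥⇒orthogonal hg x x⊥ hg′ os

  EvenHeavy : ℕ → Word n → Set
  EvenHeavy d x = 2 ∣ ewt x × (ewt x ≡ 0 ⊎ d ≤ ewt x)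

  evenHeavy? : ∀ d x → Dec (EvenHeavy d x)
  evenHeavy? d x = (2 ∣? ewt x) ×-dec ((ewt x ℕ.≟ 0) ⊎-dec (d ℕ.≤? ewt x))

  expands? : (hg : Frame n) → Dec (∀ i a → expand hg (single i a) ≡ single i a)
  expands? hg = Fin.all? λ i → all-L? λ a → expand hg (single i a) ≟W single i a

  generated? : (hg : Frame n) → Dec (All (λ p → orthogonal hg (proj₁ p) ≡ true) hg)
  generated? hg = All.all? (λ p → orthogonal hg (proj₁ p) Bool.≟ true) hg

  code-extremal : ∀ hg (x : Word n) → True (expands? hg) → True (generated? hg) →
                  onSpan (does ∘ evenHeavy? (2 * (n / 3) + 2)) hg zeroW ≡ true →
                  orthogonal hg x ≡ true → ewt x ≡ 2 * (n / 3) + 2 → Extremal (code hg)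
  code-extremal hg x expands generated heavy x∈C ewt-x = (λ y → proj₁ ∘ evenHeavy y) , selfDual , (x , x∈C , x≢0 , ewt-x) , minimal
    where
    d = 2 * (n / 3) + 2
    -- Both inclusions of self-duality, and the weight check, rest on this: a codeword equals its
    -- own expansion and so is a sum of the `h`.
    expand-id : ∀ y → expand hg y ≡ y
    expand-id = additive-ext (expand hg) (λ y → y) (expand-additive hg) (λ _ _ → refl) (toWitness expands)
    evenHeavy : ∀ y → orthogonal hg y ≡ true → EvenHeavy d y
    evenHeavy y y∈C = decided (evenHeavy? d y) (trans (cong (does ∘ evenHeavy? d) (sym (trans (⊕-identityˡ (expand hg y)) (expand-id y))))
                                                      (onSpan-expand (does ∘ evenHeavy? d) hg y zeroW y∈C heavy))
      where
      decided : ∀ {A : Set} (a? : Dec A) → does a? ≡ true → A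
      decided (yes a) _ = a
    selfDual : SelfDual (code hg)
    selfDual y = mk⇔ (λ y∈C z z∈C → trans (cong (λ u → ⟨ u , z ⟩) (sym (expand-id y))) (expand-orthogonal hg y z y∈C z∈C))
                     (λ y⊥ → ∈⊥⇒orthogonal hg y y⊥ hg (toWitness generated))
    x≢0 : x ≢ zeroW
    x≢0 refl = contradiction (trans (sym (ewt-zeroW n)) ewt-x) (λ e → contradiction (trans e (ℕ.+-comm (2 * (n / 3)) 2)) λ ())
    minimal : ∀ y → y ∈C code hg → y ≢ zeroW → d ≤ ewt y
    minimal y y∈C y≢0 with proj₂ (evenHeavy y y∈C)
    ... | inj₁ e = contradiction (ewt≡0⇒zeroW y e) y≢0
    ... | inj₂ p = p

-- Extremal codes

module _ {n : ℕ} (adjacent : ℕ → ℕ → Bool) where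

  graphRow : Fin n → Word n
  graphRow i = Vec.tabulate λ j → if toℕ i ≡ᵇ toℕ j then ω else if adjacent (toℕ i) (toℕ j) then 1L else 0L

  -- The word with 1 at `i` pairs to 1 with the `ω` in row `i`, and to 0 with the other rows, which
  -- have 0 or 1 there.
  graphFrame : Frame n
  graphFrame = tabulate λ i → graphRow i , single i 1L

  -- The code of the two-graph of the given graph together with an isolated point.
  twoGraphFrame : Frame (suc n)
  twoGraphFrame = (Vec.replicate _ 1L , single zero ω) ∷ tabulate λ i → (ω ∷ graphRow i) , single (suc i) 1L

-- Differences are not reduced modulo the number of vertices, so a list for a genuine circulant
-- graph on `m` vertices contains `m - d` along with `d`.
circulant : List ℕ → ℕ → ℕ → Bool
circulant ds i j = any (_≡ᵇ ∣ i - j ∣) ds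

-- The 3 by 3 rook's graph, which is the Paley graph on nine vertices.
rook : ℕ → ℕ → Bool
rook i j = (i / 3 ≡ᵇ j / 3) xor (i % 3 ≡ᵇ j % 3)

-- A cone with apex 10 over a 5-regular graph: a pentagram on 0 to 4, a pentagon on 5 to 9, and
-- `i < 5 ≤ j` joined unless `j - i` is 0 or 1 modulo 5.
elevenVertexGraph : ℕ → ℕ → Bool
elevenVertexGraph 10 j  = true
elevenVertexGraph i  10 = true
elevenVertexGraph i  j  with i / 5 | j / 5
... | 0 | 0 = circulant (2 ∷ 3 ∷ []) i j
... | 1 | 1 = circulant (1 ∷ 4 ∷ []) i j
... | _ | _ = circulant (2 ∷ 3 ∷ 4 ∷ 7 ∷ 8 ∷ 9 ∷ []) i j

graphCode-extremal : ∀ {n} adjacent (i : Fin n) → let hg = graphFrame {n} adjacent; x = graphRow adjacent i in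
  True (expands? hg) → True (generated? hg) → onSpan (does ∘ evenHeavy? (2 * (n / 3) + 2)) hg zeroW ≡ true →
  orthogonal hg x ≡ true → ewt x ≡ 2 * (n / 3) + 2 → ∃ λ (C : LCode n) → Extremal C
graphCode-extremal adjacent i e g h o w = code (graphFrame adjacent) , code-extremal (graphFrame adjacent) (graphRow adjacent i) e g h o w

twoGraphCode-extremal : ∀ {n} adjacent (i : Fin n) → let hg = twoGraphFrame {n} adjacent; x = ω ∷ graphRow adjacent i in
  True (expands? hg) → True (generated? hg) → onSpan (does ∘ evenHeavy? (2 * (suc n / 3) + 2)) hg zeroW ≡ true →
  orthogonal hg x ≡ true → ewt x ≡ 2 * (suc n / 3) + 2 → ∃ λ (C : LCode (suc n)) → Extremal C
twoGraphCode-extremal adjacent i e g h o w = code (twoGraphFrame adjacent) , code-extremal (twoGraphFrame adjacent) (ω ∷ graphRow adjacent i) e g h o w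

-- All conditions hold by evaluation, and the row of vertex 0 always attains the minimal weight. The
-- first graphs are edgeless (twice), the triangle, the 4-cycle and the pentagon.
extremal-exists : (n : ℕ) → n ∈ (1 ∷ 2 ∷ 3 ∷ 4 ∷ 5 ∷ 6 ∷ 7 ∷ 8 ∷ 10 ∷ 11 ∷ []) → ∃ λ (C : LCode n) → Extremal C
extremal-exists _ (here refl) = graphCode-extremal (circulant []) zero tt tt refl refl refl
extremal-exists _ (there (here refl)) = graphCode-extremal (circulant []) zero tt tt refl refl refl
extremal-exists _ (there (there (here refl))) = graphCode-extremal (circulant (1 ∷ 2 ∷ [])) zero tt tt refl refl refl
extremal-exists _ (there (there (there (here refl)))) = graphCode-extremal (circulant (1 ∷ 3 ∷ [])) zero tt tt refl refl refl
extremal-exists _ (there (there (there (there (here refl))))) = graphCode-extremal (circulant (1 ∷ 4 ∷ [])) zero tt tt refl refl refl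
extremal-exists _ (there (there (there (there (there (here refl)))))) = twoGraphCode-extremal (circulant (1 ∷ 4 ∷ [])) zero tt tt refl refl refl
extremal-exists _ (there (there (there (there (there (there (here refl))))))) = graphCode-extremal (circulant (2 ∷ 3 ∷ 4 ∷ 5 ∷ [])) zero tt tt refl refl refl
extremal-exists _ (there (there (there (there (there (there (there (here refl)))))))) = graphCode-extremal (circulant (2 ∷ 3 ∷ 5 ∷ 6 ∷ [])) zero tt tt refl refl refl
extremal-exists _ (there (there (there (there (there (there (there (there (here refl))))))))) = twoGraphCode-extremal rook zero tt tt refl refl refl
extremal-exists _ (there (there (there (there (there (there (there (there (there (here refl)))))))))) = graphCode-extremal elevenVertexGraph zero tt tt refl refl refl

-- Words with all coordinates in {0, 1}

-- Membership in {0, 1} is written as the vanishing of a linear form, so that closure under addition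
-- is bilinearity.
Binary : L → Set
Binary a = a ·L 1L ≡ false

binary? : ∀ a → Dec (Binary a)
binary? a = a ·L 1L Bool.≟ false

Binary-+ : ∀ a b → Binary a → Binary b → Binary (a +L b)
Binary-+ a b p r = trans (·L-distribʳ a b 1L) (cong₂ _xor_ p r)

¬Binary⇒Binary-+ω : ∀ a → ¬ Binary a → Binary (a +L ω)
¬Binary⇒Binary-+ω = toWitness {a? = all-L? λ a → ¬? (binary? a) →-dec binary? (a +L ω)} tt

Binary-orthogonal : ∀ a b → Binary a → Binary b → a ·L b ≡ false
Binary-orthogonal = toWitness {a? = all-L? λ a → all-L? λ b → binary? a →-dec binary? b →-dec a ·L b Bool.≟ false} tt

BinaryW : ∀ {n} → Word n → Set
BinaryW x = ∀ i → Binary (lookup x i)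

any-L? : {P : L → Set} → (∀ a → Dec (P a)) → Dec (∃ P)
any-L? P? = map′ (λ { (inj₁ p) → 0L , p ; (inj₂ (inj₁ p)) → 1L , p ; (inj₂ (inj₂ (inj₁ p))) → ω , p ; (inj₂ (inj₂ (inj₂ p))) → ω̄ , p })
                 (λ { (0L , p) → inj₁ p ; (1L , p) → inj₂ (inj₁ p) ; (ω , p) → inj₂ (inj₂ (inj₁ p)) ; (ω̄ , p) → inj₂ (inj₂ (inj₂ p)) })
                 (P? 0L ⊎-dec P? 1L ⊎-dec P? ω ⊎-dec P? ω̄)

any-Word? : ∀ {n} {P : Word n → Set} → (∀ x → Dec (P x)) → Dec (∃ P)
any-Word? {zero}  P? = map′ ([] ,_) (λ { ([] , p) → p }) (P? [])
any-Word? {suc n} P? = map′ (λ (a , x , p) → a ∷ x , p) (λ { (a ∷ x , p) → a , x , p })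
                            (any-L? λ a → any-Word? λ x → P? (a ∷ x))

lookup-⊕ : ∀ {n} (x y : Word n) i → lookup (x ⊕ y) i ≡ lookup x i +L lookup y i
lookup-⊕ x y i = lookup-zipWith _+L_ i x y

⟨⟩-distribˡ : ∀ {n} (x y z : Word n) → ⟨ x , y ⊕ z ⟩ ≡ ⟨ x , y ⟩ xor ⟨ x , z ⟩
⟨⟩-distribˡ x y z = trans (⟨⟩-comm x (y ⊕ z)) (trans (⟨⟩-distribʳ y z x) (cong₂ _xor_ (⟨⟩-comm y x) (⟨⟩-comm z x)))

⟨⟩-single : ∀ {n} (x : Word n) i a → ⟨ x , single i a ⟩ ≡ lookup x i ·L a
⟨⟩-single (b ∷ x) zero    a = trans (cong ((b ·L a) xor_) (trans (⟨⟩-comm x zeroW) (⟨⟩-zeroˡ x))) (Bool.xor-identityʳ (b ·L a))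
⟨⟩-single (b ∷ x) (suc i) a = trans (cong (_xor ⟨ x , single i a ⟩) (·-zeroʳ b)) (⟨⟩-single x i a)
  where
  ·-zeroʳ : ∀ b → b ·L 0L ≡ false
  ·-zeroʳ = toWitness {a? = all-L? λ b → b ·L 0L Bool.≟ false} tt

BinaryW-zeroW : ∀ {n} → BinaryW (zeroW {n})
BinaryW-zeroW i = cong (_·L 1L) (lookup-replicate i 0L)

-- Since `P` contains all binary words, only the class of the first letter modulo {0, 1} matters; 0
-- and `ω` represent the two classes.
module Head {n : ℕ} (P : Word (suc n) → Set) (P-⊕ : ∀ {x y} → P x → P y → P (x ⊕ y)) (P-bin : ∀ {x} → BinaryW x → P x) where

  shift-head : ∀ b {a c x} → Binary b → b +L a ≡ c → P (a ∷ x) → P (c ∷ x)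
  shift-head b {a} {c} {x} p e Px =
    subst P (cong₂ _∷_ e (⊕-identityˡ x)) (P-⊕ (P-bin {b ∷ zeroW} λ { zero → p ; (suc i) → BinaryW-zeroW i }) Px)

  head→0 : ∀ {a x} → Binary a → P (a ∷ x) → P (0L ∷ x)
  head→0 {a} p = shift-head a p (+L-self a)

  0→head : ∀ {a x} → Binary a → P (0L ∷ x) → P (a ∷ x)
  0→head {a} p = shift-head a p (+L-identityʳ a)

  head→ω : ∀ {a x} → ¬ Binary a → P (a ∷ x) → P (ω ∷ x)
  head→ω {a} ¬p = shift-head (a +L ω) (¬Binary⇒Binary-+ω a ¬p) (cancel a)
    where
    cancel : ∀ a → (a +L ω) +L a ≡ ω
    cancel = toWitness {a? = all-L? λ a → _ ≟L _} tt

  ω→head : ∀ {a x} → ¬ Binary a → P (ω ∷ x) → P (a ∷ x)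
  ω→head {a} ¬p = shift-head (a +L ω) (¬Binary⇒Binary-+ω a ¬p) (trans (+L-assoc a ω ω) (+L-identityʳ a))

-- Modulo the words over {0, 1} this says that a subspace of F₂ⁿ is
-- cut out by the linear forms vanishing on it.
separate : ∀ {n} {P : Word n → Set} → (∀ x → Dec (P x)) → (∀ {x y} → P x → P y → P (x ⊕ y)) →
           (∀ {x} → BinaryW x → P x) → ∀ t → ¬ P t →
           ∃ λ u → BinaryW u × (∀ x → P x → ⟨ u , x ⟩ ≡ false) × ⟨ u , t ⟩ ≡ true
separate {zero}  P? P-⊕ P-bin []      ¬Pt = contradiction (P-bin λ ()) ¬Pt
separate {suc n} {P} P? P-⊕ P-bin (a ∷ t) ¬Pt = cases (any-Word? (λ v → P? (ω ∷ v))) (binary? a)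
  where
  open Head P P-⊕ P-bin

  Separator : Set
  Separator = ∃ λ u → BinaryW u × (∀ x → P x → ⟨ u , x ⟩ ≡ false) × ⟨ u , a ∷ t ⟩ ≡ true

  separateTail : ∀ t → ¬ P (0L ∷ t) → ∃ λ u → BinaryW u × (∀ x → P (0L ∷ x) → ⟨ u , x ⟩ ≡ false) × ⟨ u , t ⟩ ≡ true
  separateTail = separate (λ x → P? (0L ∷ x)) P-⊕ (λ b → P-bin λ { zero → refl ; (suc i) → b i })

  -- Gaussian elimination: adding `ω ∷ v` clears a first letter outside {0, 1}, and the tail is
  -- separated by induction.
  module Sweep (v : Word n) (Pωv : P (ω ∷ v)) where

    clear : L → Word n → Word n
    clear a x with binary? a
    ... | yes _ = x
    ... | no  _ = x ⊕ v

    clear⁻ : ∀ a x → P (0L ∷ clear a x) → P (a ∷ x)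
    clear⁻ a x Px with binary? a
    ... | yes p = 0→head p Px
    ... | no ¬p = ω→head ¬p
      (subst (λ y → P (ω ∷ y)) (trans (⊕-assoc x v v) (trans (cong (x ⊕_) (⊕-self v)) (⊕-identityʳ x))) (P-⊕ Px Pωv))

    clear⁺ : ∀ a x → P (a ∷ x) → P (0L ∷ clear a x)
    clear⁺ a x Px with binary? a
    ... | yes p = head→0 p Px
    ... | no ¬p = P-⊕ (head→ω ¬p Px) Pωv

    coeff : Bool → L
    coeff c = if c then 1L else 0L

    coeff-binary : ∀ c → Binary (coeff c)
    coeff-binary false = refl
    coeff-binary true  = refl

    coeff-· : ∀ c b → ¬ Binary b → coeff c ·L b ≡ c
    coeff-· false = toWitness {a? = all-L? λ b → ¬? (binary? b) →-dec (0L ·L b Bool.≟ false)} tt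
    coeff-· true  = toWitness {a? = all-L? λ b → ¬? (binary? b) →-dec (1L ·L b Bool.≟ true)} tt

    -- The first coordinate of the separating word is chosen so that it kills ω ∷ v.
    pair : ∀ u b x → ⟨ coeff ⟨ u , v ⟩ ∷ u , b ∷ x ⟩ ≡ ⟨ u , clear b x ⟩
    pair u b x with binary? b
    ... | yes p = cong (_xor ⟨ u , x ⟩) (Binary-orthogonal (coeff ⟨ u , v ⟩) b (coeff-binary ⟨ u , v ⟩) p)
    ... | no ¬p = trans (cong (_xor ⟨ u , x ⟩) (coeff-· ⟨ u , v ⟩ b ¬p))
                        (trans (Bool.xor-comm ⟨ u , v ⟩ ⟨ u , x ⟩) (sym (⟨⟩-distribˡ u x v)))

    separator : Separator
    separator with separateTail (clear a t) (¬Pt ∘ clear⁻ a t)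
    ... | u , u-bin , u⊥ , ut = coeff ⟨ u , v ⟩ ∷ u , (λ { zero → coeff-binary ⟨ u , v ⟩ ; (suc i) → u-bin i }) ,
      (λ { (b ∷ x) Px → trans (pair u b x) (u⊥ (clear b x) (clear⁺ b x Px)) }) , trans (pair u a t) ut

  -- All members of `P` have a binary first letter. If that of the target is not binary, the first
  -- coordinate alone separates; otherwise it is ignored.
  module NoSweep (∄v : ¬ ∃ λ v → P (ω ∷ v)) where

    binary-head : ∀ b x → P (b ∷ x) → Binary b
    binary-head b x Px with binary? b
    ... | yes p = p
    ... | no ¬p = contradiction (x , head→ω ¬p Px) ∄v

    separator : Dec (Binary a) → Separator
    separator (no ¬p) = 1L ∷ zeroW , (λ { zero → refl ; (suc i) → BinaryW-zeroW i }) ,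
      (λ { (b ∷ x) Px → cong₂ _xor_ (Binary-orthogonal 1L b refl (binary-head b x Px)) (⟨⟩-zeroˡ x) }) ,
      cong₂ _xor_ (one a ¬p) (⟨⟩-zeroˡ t)
      where
      one : ∀ a → ¬ Binary a → 1L ·L a ≡ true
      one = toWitness {a? = all-L? λ a → ¬? (binary? a) →-dec (1L ·L a Bool.≟ true)} tt
    separator (yes p) with separateTail t (¬Pt ∘ 0→head p)
    ... | u , u-bin , u⊥ , ut = 0L ∷ u , (λ { zero → refl ; (suc i) → u-bin i }) ,
      (λ { (b ∷ x) Px → let p′ = binary-head b x Px in
             trans (cong (_xor ⟨ u , x ⟩) (Binary-orthogonal 0L b refl p′)) (u⊥ x (head→0 p′ Px)) }) ,
      trans (cong (_xor ⟨ u , t ⟩) (Binary-orthogonal 0L a refl p)) ut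

  cases : Dec (∃ λ v → P (ω ∷ v)) → Dec (Binary a) → Separator
  cases (yes (v , Pωv)) _ = Sweep.separator v Pωv
  cases (no ∄v)         p = NoSweep.separator ∄v p

-- Codewords with prescribed support of the ω-coordinates

module _ {n : ℕ} where

  -- J are the positions treated before k; both alternatives make x independent
  -- of earlier words already on k ∷ J.
  data Pivot (J : List (Fin n)) (k : Fin n) (x : Word n) : Set where
    mixed  : ¬ Binary (lookup x k) → (∀ l → l ∉ k ∷ J → Binary (lookup x l)) → Pivot J k x
    binary : BinaryW x → lookup x k ≡ 1L → (∀ l → l ∈ J → lookup x l ≡ 0L) → Pivot J k x

  pivot-binary : ∀ {J k} x → Pivot J k x → ∀ l → l ∉ k ∷ J → Binary (lookup x l)
  pivot-binary _ (mixed _ b)    = b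
  pivot-binary _ (binary b _ _) = λ l _ → b l

  -- Let `P` be the sum of `C`, the binary words and the words supported on `J`. If `ω` at `k` lies
  -- in `P`, its `C`-part is a mixed pivot. If not, a binary word separating it from `P` is
  -- orthogonal to `C`, so self-duality puts it in `C`; it vanishes on `J` because `P` contains `ω`
  -- at each place of `J`.
  selfDual-pivot : (C : LCode n) → SelfDual C → ∀ J k → k ∉ J → ∃ λ x → x ∈C C × Pivot J k x
  selfDual-pivot C sd J k k∉J = cases (P? (single k ω))
    where
    P : Word n → Set
    P x = ∃ λ c → c ∈C C × (∀ l → l ∈ J ⊎ Binary (lookup (x ⊕ c) l))

    P? : ∀ x → Dec (P x)
    P? x = any-Word? λ c → (mem C c Bool.≟ true) ×-dec Fin.all? λ l → _∈?_ Fin._≟_ l J ⊎-dec binary? (lookup (x ⊕ c) l)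

    P-⊕ : ∀ {x y} → P x → P y → P (x ⊕ y)
    P-⊕ {x} {y} (c , c∈C , p) (d , d∈C , r) = c ⊕ d , mem-⊕ C c d c∈C d∈C , λ l → both l (p l) (r l)
      where
      both : ∀ l → l ∈ J ⊎ Binary (lookup (x ⊕ c) l) → l ∈ J ⊎ Binary (lookup (y ⊕ d) l) →
             l ∈ J ⊎ Binary (lookup ((x ⊕ y) ⊕ (c ⊕ d)) l)
      both l (inj₁ l∈J) _          = inj₁ l∈J
      both l (inj₂ _)   (inj₁ l∈J) = inj₁ l∈J
      both l (inj₂ b)   (inj₂ b′)  = inj₂ (subst Binary
        (trans (sym (lookup-⊕ (x ⊕ c) (y ⊕ d) l)) (cong (λ u → lookup u l) (⊕-medial x c y d)))
        (Binary-+ (lookup (x ⊕ c) l) (lookup (y ⊕ d) l) b b′))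

    P-bin : ∀ {x} → BinaryW x → P x
    P-bin {x} b = zeroW , mem-0 C , λ l → inj₂ (subst (λ u → Binary (lookup u l)) (sym (⊕-identityʳ x)) (b l))

    P-code : ∀ x → x ∈C C → P x
    P-code x x∈C = x , x∈C , λ l → inj₂ (subst (λ u → Binary (lookup u l)) (sym (⊕-self x)) (BinaryW-zeroW l))

    P-single : ∀ {l} → l ∈ J → P (single l ω)
    P-single {l} l∈J = zeroW , mem-0 C , at
      where
      at : ∀ i → i ∈ J ⊎ Binary (lookup (single l ω ⊕ zeroW) i)
      at i with i Fin.≟ l
      ... | yes refl = inj₁ l∈J
      ... | no i≢l   = inj₂ (subst Binary (sym (trans (cong (λ u → lookup u i) (⊕-identityʳ (single l ω))) (lookup∘update′ i≢l zeroW ω))) (BinaryW-zeroW i))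

    ω·⇒1 : ∀ a → Binary a → a ·L ω ≡ true → a ≡ 1L
    ω·⇒1 = toWitness {a? = all-L? λ a → binary? a →-dec (a ·L ω Bool.≟ true) →-dec (a ≟L 1L)} tt

    ω·⇒0 : ∀ a → Binary a → a ·L ω ≡ false → a ≡ 0L
    ω·⇒0 = toWitness {a? = all-L? λ a → binary? a →-dec (a ·L ω Bool.≟ false) →-dec (a ≟L 0L)} tt

    ω+Binary : ∀ a → Binary (ω +L a) → ¬ Binary a
    ω+Binary = toWitness {a? = all-L? λ a → binary? (ω +L a) →-dec ¬? (binary? a)} tt

    cases : Dec (P (single k ω)) → ∃ λ x → x ∈C C × Pivot J k x
    cases (yes (c , c∈C , b)) = c , c∈C , mixed at-k off
      where
      at-k : ¬ Binary (lookup c k)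
      at-k with b k
      ... | inj₁ k∈J = contradiction k∈J k∉J
      ... | inj₂ p   = ω+Binary (lookup c k) (subst Binary (trans (lookup-⊕ (single k ω) c k) (cong (_+L lookup c k) (lookup∘update k zeroW ω))) p)
      off : ∀ l → l ∉ k ∷ J → Binary (lookup c l)
      off l l∉ with b l
      ... | inj₁ l∈J = contradiction (there l∈J) l∉
      ... | inj₂ p   = subst Binary (trans (lookup-⊕ (single k ω) c l) (cong (_+L lookup c l) (trans (lookup∘update′ (l∉ ∘ here) zeroW ω) (lookup-replicate l 0L)))) p
    cases (no ¬P) with separate P? (λ {x} {y} → P-⊕ {x} {y}) (λ {x} → P-bin {x}) (single k ω) ¬P
    ... | u , u-bin , u⊥ , uk = u , Equivalence.from (sd u) (λ y → u⊥ y ∘ P-code y) , binary u-bin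
      (ω·⇒1 (lookup u k) (u-bin k) (trans (sym (⟨⟩-single u k ω)) uk))
      (λ l l∈J → ω·⇒0 (lookup u l) (u-bin l) (trans (sym (⟨⟩-single u l ω)) (u⊥ (single l ω) (P-single l∈J))))

  NonzeroOn : List (Fin n) → Word n → Set
  NonzeroOn K x = ∃ λ l → l ∈ K × lookup x l ≢ 0L

  nonzeroOn⇒≢zeroW : ∀ {K x} → NonzeroOn K x → x ≢ zeroW
  nonzeroOn⇒≢zeroW (l , _ , x≢0) refl = x≢0 (lookup-replicate l 0L)

  nonzeroOn-there : ∀ {J k x} → NonzeroOn J x → NonzeroOn (k ∷ J) x
  nonzeroOn-there (l , l∈J , x≢0) = l , there l∈J , x≢0

  pivot-nonzero : ∀ {J k x} → Pivot J k x → NonzeroOn (k ∷ J) x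
  pivot-nonzero {J} {k} (mixed ¬b _) = k , here refl , λ e → ¬b (cong (_·L 1L) e)
  pivot-nonzero {J} {k} (binary _ e _) = k , here refl , λ e₀ → contradiction (trans (sym e) e₀) λ ()

  -- In the mixed case the letters at `k` lie in different classes modulo {0, 1} and cannot cancel.
  -- In the binary case `x` vanishes on `J`, so `y` survives there.
  pivot-⊕-nonzero : ∀ {J k x} y → Pivot J k x → NonzeroOn J y → Binary (lookup y k) → NonzeroOn (k ∷ J) (y ⊕ x)
  pivot-⊕-nonzero {J} {k} {x} y (mixed ¬b _) _ yk =
    k , here refl , λ e → nonzero (lookup y k) (lookup x k) yk ¬b (trans (sym (lookup-⊕ y x k)) e)
    where
    nonzero : ∀ a b → Binary a → ¬ Binary b → a +L b ≢ 0L
    nonzero = toWitness {a? = all-L? λ a → all-L? λ b → binary? a →-dec ¬? (binary? b) →-dec ¬? ((a +L b) ≟L 0L)} tt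
  pivot-⊕-nonzero {x = x} y (binary _ _ x0) (l , l∈J , y≢0) _ =
    l , there l∈J , λ e → y≢0 (trans (sym (trans (lookup-⊕ y x l) (trans (cong (lookup y l +L_) (x0 l l∈J)) (+L-identityʳ (lookup y l))))) e)

-- The weight bound

-- The total weight of the seven nonzero combinations of `a`, `b`, `c`.
cube : L → L → L → ℕ
cube a b c = norm² a + norm² b + norm² (a +L b) + norm² c + norm² (a +L c) + norm² (b +L c) + norm² ((a +L b) +L c)

cubeW : ∀ {n} → Word n → Word n → Word n → ℕ
cubeW a b c = ewt a + ewt b + ewt (a ⊕ b) + ewt c + ewt (a ⊕ c) + ewt (b ⊕ c) + ewt ((a ⊕ b) ⊕ c)

cubeW≡∑cube : ∀ {n} (a b c : Word n) → cubeW a b c ≡ sum (λ l → cube (lookup a l) (lookup b l) (lookup c l))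
cubeW≡∑cube []      []      []      = refl
cubeW≡∑cube (a ∷ x) (b ∷ y) (c ∷ z) =
  trans (regroup (norm² a) (norm² b) (norm² (a +L b)) (norm² c) (norm² (a +L c)) (norm² (b +L c)) (norm² ((a +L b) +L c))
                 (ewt x) (ewt y) (ewt (x ⊕ y)) (ewt z) (ewt (x ⊕ z)) (ewt (y ⊕ z)) (ewt ((x ⊕ y) ⊕ z)))
        (cong (cube a b c +_) (cubeW≡∑cube x y z))
  where
  regroup : ∀ a b c d e f g a′ b′ c′ d′ e′ f′ g′ →
            (a + a′) + (b + b′) + (c + c′) + (d + d′) + (e + e′) + (f + f′) + (g + g′) ≡
            (a + b + c + d + e + f + g) + (a′ + b′ + c′ + d′ + e′ + f′ + g′)
  regroup a b c d e f g a′ b′ c′ d′ e′ f′ g′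
    rewrite interchange a a′ b b′
          | interchange (a + b) (a′ + b′) c c′
          | interchange (a + b + c) (a′ + b′ + c′) d d′
          | interchange (a + b + c + d) (a′ + b′ + c′ + d′) e e′
          | interchange (a + b + c + d + e) (a′ + b′ + c′ + d′ + e′) f f′
    = interchange (a + b + c + d + e + f) (a′ + b′ + c′ + d′ + e′ + f′) g g′

-- The eight combinations take each value in the subgroup spanned by the letters equally often: at
-- most 2(1+2+2) = 10 in general, and 4 when the subgroup is {0, 1}.
cube≤10 : ∀ a b c → cube a b c ≤ 10
cube≤10 = toWitness {a? = all-L? λ a → all-L? λ b → all-L? λ c → cube a b c ℕ.≤? 10} tt

cube≤4 : ∀ a b c → Binary a → Binary b → Binary c → cube a b c ≤ 4
cube≤4 = toWitness {a? = all-L? λ a → all-L? λ b → all-L? λ c →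
  binary? a →-dec binary? b →-dec binary? c →-dec (cube a b c ℕ.≤? 4)} tt

sum-mono : ∀ {n} {f g : Fin n → ℕ} → (∀ i → f i ≤ g i) → sum f ≤ sum g
sum-mono {zero}  f≤g = z≤n
sum-mono {suc n} f≤g = ℕ.+-mono-≤ (f≤g zero) (sum-mono (f≤g ∘ suc))

spike : ∀ {n} → Fin n → ℕ → Fin n → ℕ
spike i w l = if does (i Fin.≟ l) then w else 0

sum-spike : ∀ {n} (i : Fin n) w → sum (spike i w) ≡ w
sum-spike {suc n} zero    w = trans (cong (w +_) (sum-replicate-zero n)) (ℕ.+-identityʳ w)
sum-spike         (suc i) w = sum-spike i w

spike-refl : ∀ {n} (i : Fin n) w → spike i w i ≡ w
spike-refl i w with i Fin.≟ i
... | yes _  = refl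
... | no i≢i = contradiction refl i≢i

-- The 6 is the excess of the bound 10 on `K` over the bound 4 elsewhere.
surplus : ∀ {n} → List (Fin n) → Fin n → ℕ
surplus []      l = 0
surplus (k ∷ K) l = spike k 6 l + surplus K l

surplus-∈ : ∀ {n} {K : List (Fin n)} {l} → l ∈ K → 6 ≤ surplus K l
surplus-∈ {K = k ∷ K} {l} (here refl) = subst (λ s → 6 ≤ s + surplus K l) (sym (spike-refl l 6)) (ℕ.m≤m+n 6 _)
surplus-∈ {K = k ∷ K} {l} (there l∈K) = ℕ.≤-trans (surplus-∈ l∈K) (ℕ.m≤n+m _ (spike k 6 l))

sum-4+surplus : ∀ {n} (K : List (Fin n)) → sum (λ l → 4 + surplus K l) ≡ n * 4 + length K * 6
sum-4+surplus {n} K = trans (∑-distrib-+ (λ _ → 4) (surplus K)) (cong₂ _+_ (sum-const n) (sum-surplus K))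
  where
  sum-const : ∀ n → sum {n} (λ _ → 4) ≡ n * 4
  sum-const zero    = refl
  sum-const (suc n) = cong (4 +_) (sum-const n)
  sum-surplus : ∀ K → sum (surplus K) ≡ length K * 6
  sum-surplus []      = sum-replicate-zero n
  sum-surplus (k ∷ K) = trans (∑-distrib-+ (spike k 6) (surplus K)) (cong₂ _+_ (sum-spike k 6) (sum-surplus K))

-- Plotkin's averaging over the group spanned by a, b, c.
module _ {n : ℕ} (K : List (Fin n)) (a b c : Word n)
         (off : ∀ l → l ∉ K → Binary (lookup a l) × Binary (lookup b l) × Binary (lookup c l)) where

  private
    at : Fin n → ℕ
    at l = cube (lookup a l) (lookup b l) (lookup c l)

    at≤ : ∀ l → at l ≤ 4 + surplus K l
    at≤ l with _∈?_ Fin._≟_ l K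
    ... | yes l∈K = ℕ.≤-trans (cube≤10 (lookup a l) (lookup b l) (lookup c l)) (ℕ.+-monoʳ-≤ 4 (surplus-∈ l∈K))
    ... | no l∉K  = let (p , r , s) = off l l∉K in
                    ℕ.≤-trans (cube≤4 (lookup a l) (lookup b l) (lookup c l) p r s) (ℕ.m≤m+n 4 _)

  cubeW-≤ : cubeW a b c ≤ n * 4 + length K * 6
  cubeW-≤ = subst₂ _≤_ (sym (cubeW≡∑cube a b c)) (sum-4+surplus K) (sum-mono at≤)

  -- A coordinate where all three words vanish contributes nothing, which saves the 4 allotted to
  -- it.
  cubeW-≤-vanishing : ∀ v → lookup a v ≡ 0L → lookup b v ≡ 0L → lookup c v ≡ 0L → cubeW a b c + 4 ≤ n * 4 + length K * 6
  cubeW-≤-vanishing v a0 b0 c0 =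
    subst₂ _≤_ (trans (∑-distrib-+ at (spike v 4)) (cong₂ _+_ (sym (cubeW≡∑cube a b c)) (sum-spike v 4))) (sum-4+surplus K) (sum-mono bound)
    where
    bound : ∀ l → at l + spike v 4 l ≤ 4 + surplus K l
    bound l with v Fin.≟ l
    ... | no _     = subst (_≤ 4 + surplus K l) (sym (ℕ.+-identityʳ (at l))) (at≤ l)
    ... | yes refl rewrite a0 | b0 | c0 = ℕ.m≤m+n 4 _

module _ {n d : ℕ} (C : LCode n) (heavy : ∀ x → x ∈C C → x ≢ zeroW → d ≤ ewt x) where

  -- The pivots make all seven combinations nonzero. The weight of `a` is kept exact, since the
  -- averaging is also used to bound it from above.
  cubeW-≥ : ∀ {i j k} → j ∉ i ∷ [] → k ∉ j ∷ i ∷ [] → ∀ {a b c} → a ∈C C → b ∈C C → c ∈C C →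
            Pivot [] i a → Pivot (i ∷ []) j b → Pivot (j ∷ i ∷ []) k c →
            d ≤ ewt a × ewt a + 6 * d ≤ cubeW a b c
  cubeW-≥ {i} {j} {k} j∉ k∉ {a} {b} {c} a∈ b∈ c∈ pa pb pc =
    ge a∈ na , ℕ.≤-trans (ℕ.≤-reflexive (six (ewt a) d))
      (ℕ.+-mono-≤ (ℕ.+-mono-≤ (ℕ.+-mono-≤ (ℕ.+-mono-≤ (ℕ.+-mono-≤ (ℕ.+-monoʳ-≤ (ewt a)
        (ge b∈ nb)) (ge (mem-⊕ C a b a∈ b∈) nab)) (ge c∈ nc)) (ge (mem-⊕ C a c a∈ c∈) nac)) (ge (mem-⊕ C b c b∈ c∈) nbc))
        (ge (mem-⊕ C (a ⊕ b) c (mem-⊕ C a b a∈ b∈) c∈) nabc))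
    where
    six : ∀ e d → e + 6 * d ≡ e + d + d + d + d + d + d
    six = solve-∀
    ge : ∀ {K x} → x ∈C C → NonzeroOn K x → d ≤ ewt x
    ge {x = x} x∈C nx = heavy x x∈C (nonzeroOn⇒≢zeroW nx)
    na = pivot-nonzero pa
    nb = pivot-nonzero pb
    nab = pivot-⊕-nonzero a pb na (pivot-binary a pa j j∉)
    ak : Binary (lookup a k)
    ak = pivot-binary a pa k (k∉ ∘ there)
    bk : Binary (lookup b k)
    bk = pivot-binary b pb k k∉
    nc = pivot-nonzero pc
    nac = pivot-⊕-nonzero a pc (nonzeroOn-there {x = a} na) ak
    nbc = pivot-⊕-nonzero b pc nb bk
    nabc = pivot-⊕-nonzero (a ⊕ b) pc nab (subst Binary (sym (lookup-⊕ a b k)) (Binary-+ (lookup a k) (lookup b k) ak bk))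

-- Zeros of light words, and coordinates forced to vanish by orthogonality.

zero-coordinate : ∀ {n} (x : Word n) → suc (ewt x) ≤ n → ∃ λ i → lookup x i ≡ 0L
zero-coordinate (0L ∷ x) _       = zero , refl
zero-coordinate (1L ∷ x) (s≤s p) = let (i , e) = zero-coordinate x p in suc i , e
zero-coordinate (ω ∷ x)  (s≤s p) = let (i , e) = zero-coordinate x (ℕ.≤-trans (ℕ.n≤1+n _) p) in suc i , e
zero-coordinate (ω̄ ∷ x)  (s≤s p) = let (i , e) = zero-coordinate x (ℕ.≤-trans (ℕ.n≤1+n _) p) in suc i , e

ewt-fill : ∀ {n} (x : Word n) i → lookup x i ≡ 0L → ewt (x [ i ]≔ 1L) ≡ suc (ewt x)
ewt-fill (0L ∷ x) zero    _ = refl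
ewt-fill (a ∷ x)  (suc i) e = trans (cong (norm² a +_) (ewt-fill x i e)) (ℕ.+-suc (norm² a) (ewt x))

another-zero : ∀ {n} (x : Word n) i → lookup x i ≡ 0L → ∀ j → lookup (x [ i ]≔ 1L) j ≡ 0L → j ≢ i × lookup x j ≡ 0L
another-zero x i e j e′ with j Fin.≟ i
... | yes refl = contradiction (trans (sym (lookup∘update i x 1L)) e′) λ ()
... | no j≢i   = j≢i , trans (sym (lookup∘update′ j≢i x 1L)) e′

-- Filling each zero found with a 1 raises the weight by one and forces the next zero to be at a new
-- place.
three-zeros : ∀ {n} (x : Word n) → ewt x + 3 ≤ n →
              ∃ λ i → ∃ λ j → ∃ λ k → j ∉ i ∷ [] × k ∉ j ∷ i ∷ [] × (∀ l → l ∈ k ∷ j ∷ i ∷ [] → lookup x l ≡ 0L)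
three-zeros {n} x p =
  let x₁≤ = ℕ.≤-trans (ℕ.≤-reflexive (ℕ.+-comm 1 (ewt x))) (ℕ.≤-trans (ℕ.+-monoʳ-≤ (ewt x) (s≤s z≤n)) p)
      (i , xi) = zero-coordinate x x₁≤
      y  = x [ i ]≔ 1L
      ey = ewt-fill x i xi
      (j , yj) = zero-coordinate y (ℕ.≤-trans (ℕ.≤-reflexive (trans (cong suc ey) (ℕ.+-comm 2 (ewt x)))) (ℕ.≤-trans (ℕ.+-monoʳ-≤ (ewt x) (s≤s (s≤s z≤n))) p))
      z  = y [ j ]≔ 1L
      (k , zk) = zero-coordinate z (ℕ.≤-trans (ℕ.≤-reflexive (trans (cong suc (trans (ewt-fill y j yj) (cong suc ey))) (ℕ.+-comm 3 (ewt x)))) p)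
      (j≢i , xj) = another-zero x i xi j yj
      (k≢j , yk) = another-zero y j yj k zk
      (k≢i , xk) = another-zero x i xi k yk
  in i , j , k , (λ { (here e) → j≢i e }) , (λ { (here e) → k≢j e ; (there (here e)) → k≢i e }) ,
     λ { _ (here refl) → xk ; _ (there (here refl)) → xj ; _ (there (there (here refl))) → xi }

⟨⟩-concentrated : ∀ {n} (x y : Word n) v → (∀ l → l ≢ v → lookup x l ·L lookup y l ≡ false) → ⟨ x , y ⟩ ≡ lookup x v ·L lookup y v
⟨⟩-concentrated (a ∷ x) (b ∷ y) zero    e = trans (cong ((a ·L b) xor_) (vanish x y (λ l → e (suc l) λ ()))) (Bool.xor-identityʳ (a ·L b))
  where
  vanish : ∀ {n} (x y : Word n) → (∀ l → lookup x l ·L lookup y l ≡ false) → ⟨ x , y ⟩ ≡ false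
  vanish []      []      _ = refl
  vanish (a ∷ x) (b ∷ y) e = cong₂ _xor_ (e zero) (vanish x y (e ∘ suc))
⟨⟩-concentrated (a ∷ x) (b ∷ y) (suc v) e =
  trans (cong (_xor ⟨ x , y ⟩) (e zero λ ())) (⟨⟩-concentrated x y v (λ l l≢v → e (suc l) (l≢v ∘ Fin.suc-injective)))

-- In `⟨ a , x ⟩` the terms on `K` vanish with `x`, and those outside `K` and `v` are products of
-- binary letters. What remains is the term at `v`, where a binary letter orthogonal to a non-binary
-- one must be 0.
vanishes-at : ∀ {n} {K : List (Fin n)} (a x : Word n) v → ⟨ a , x ⟩ ≡ false → ¬ Binary (lookup x v) → (∀ l → l ≢ v → Binary (lookup x l)) →
              (∀ l → l ∈ K → lookup x l ≡ 0L) → (∀ l → l ∉ K → Binary (lookup a l)) → lookup a v ≡ 0L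
vanishes-at {K = K} a x v a⊥x ¬xv x-bin x0 a-bin =
  zero-at (lookup a v) (lookup x v) (a-bin v (λ v∈K → ¬xv (cong (_·L 1L) (x0 v v∈K)))) ¬xv (trans (sym (⟨⟩-concentrated a x v off-v)) a⊥x)
  where
  zero-at : ∀ a b → Binary a → ¬ Binary b → a ·L b ≡ false → a ≡ 0L
  zero-at = toWitness {a? = all-L? λ a → all-L? λ b → binary? a →-dec ¬? (binary? b) →-dec (a ·L b Bool.≟ false) →-dec (a ≟L 0L)} tt
  ·0 : ∀ a → a ·L 0L ≡ false
  ·0 = toWitness {a? = all-L? λ a → a ·L 0L Bool.≟ false} tt
  off-v : ∀ l → l ≢ v → lookup a l ·L lookup x l ≡ false
  off-v l l≢v with _∈?_ Fin._≟_ l K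
  ... | yes l∈K = trans (cong (lookup a l ·L_) (x0 l l∈K)) (·0 (lookup a l))
  ... | no l∉K  = Binary-orthogonal (lookup a l) (lookup x l) (a-bin l l∉K) (x-bin l l≢v)

-- The contradiction for self-dual codes of large minimal weight.

module _ {n d : ℕ} (h₁ : 3 * n + 21 ≤ 6 * d) (h₂ : 4 * n + 15 ≤ 7 * d)
         (C : LCode n) (sd : SelfDual C) (heavy : ∀ x → x ∈C C → x ≢ zeroW → d ≤ ewt x) where

  private
    pivot : ∀ J k → k ∉ J → ∃ λ x → x ∈C C × Pivot J k x
    pivot = selfDual-pivot C sd

    off₃ : ∀ {i j k : Fin n} {a b c} → Pivot [] i a → Pivot (i ∷ []) j b → Pivot (j ∷ i ∷ []) k c →
           ∀ l → l ∉ k ∷ j ∷ i ∷ [] → Binary (lookup a l) × Binary (lookup b l) × Binary (lookup c l)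
    off₃ {a = a} {b} {c} pa pb pc l l∉ =
      pivot-binary a pa l (λ { (here e) → l∉ (there (there (here e))) }) , pivot-binary b pb l (l∉ ∘ there) , pivot-binary c pc l l∉

    -- Averaging with `x` as first word gives `ewt x + 6 * d ≤ 4 * n + 18`; `h₁` says exactly that
    -- `4n + 18 - 6d ≤ n - 3`.
    light : ∀ {i j k} → j ∉ i ∷ [] → k ∉ j ∷ i ∷ [] → ∀ {x} → x ∈C C → Pivot [] i x → ewt x + 3 ≤ n
    light {i} {j} {k} j∉ k∉ {x} x∈C px with pivot (i ∷ []) j j∉ | pivot (j ∷ i ∷ []) k k∉
    ... | b , b∈C , pb | c , c∈C , pc = ℕ.+-cancelʳ-≤ (3 * n + 18) (ewt x + 3) n (begin
      (ewt x + 3) + (3 * n + 18) ≡⟨ regroup₁ (ewt x) n ⟩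
      ewt x + (3 * n + 21)       ≤⟨ ℕ.+-monoʳ-≤ (ewt x) h₁ ⟩
      ewt x + 6 * d              ≤⟨ proj₂ (cubeW-≥ C heavy j∉ k∉ x∈C b∈C c∈C px pb pc) ⟩
      cubeW x b c                ≤⟨ cubeW-≤ (k ∷ j ∷ i ∷ []) x b c (off₃ px pb pc) ⟩
      n * 4 + 18                 ≡⟨ regroup₂ n ⟩
      n + (3 * n + 18)           ∎)
      where
      open ℕ.≤-Reasoning
      regroup₁ : ∀ e n → (e + 3) + (3 * n + 18) ≡ e + (3 * n + 21)
      regroup₁ = solve-∀
      regroup₂ : ∀ n → n * 4 + 18 ≡ n + (3 * n + 18)
      regroup₂ = solve-∀

    -- All seven weights are at least `d`, and `h₂` says that `7 * d` exceeds `4 * n + 14`.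
    cubeW-large : ∀ {i j k : Fin n} → j ∉ i ∷ [] → k ∉ j ∷ i ∷ [] → ∀ {a b c} → a ∈C C → b ∈C C → c ∈C C →
                  Pivot [] i a → Pivot (i ∷ []) j b → Pivot (j ∷ i ∷ []) k c → ¬ cubeW a b c + 4 ≤ n * 4 + 18
    cubeW-large j∉ k∉ {a} {b} {c} a∈C b∈C c∈C pa pb pc p =
      let (d≤a , ≤cube) = cubeW-≥ C heavy j∉ k∉ a∈C b∈C c∈C pa pb pc in
      ℕ.1+n≰n (ℕ.+-cancelˡ-≤ (n * 4) 19 18 (begin
        n * 4 + 19          ≡⟨ regroup n ⟩
        (4 * n + 15) + 4    ≤⟨ ℕ.+-monoˡ-≤ 4 h₂ ⟩
        (d + 6 * d) + 4     ≤⟨ ℕ.+-monoˡ-≤ 4 (ℕ.+-monoˡ-≤ (6 * d) d≤a) ⟩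
        (ewt a + 6 * d) + 4 ≤⟨ ℕ.+-monoˡ-≤ 4 ≤cube ⟩
        cubeW a b c + 4     ≤⟨ p ⟩
        n * 4 + 18          ∎))
      where
      open ℕ.≤-Reasoning
      regroup : ∀ n → n * 4 + 19 ≡ (4 * n + 15) + 4
      regroup = solve-∀

    refute : ∀ {v x} → x ∈C C → ewt x + 3 ≤ n → ¬ Pivot [] v x
    refute {v} {x} x∈C x-light (mixed ¬xv x-bin) with three-zeros x x-light
    ... | i , j , k , j∉ , k∉ , x0 with pivot [] i (λ ()) | pivot (i ∷ []) j j∉ | pivot (j ∷ i ∷ []) k k∉
    ...   | a , a∈C , pa | b , b∈C , pb | c , c∈C , pc =
      cubeW-large j∉ k∉ a∈C b∈C c∈C pa pb pc
        (cubeW-≤-vanishing (k ∷ j ∷ i ∷ []) a b c off v (at a a∈C λ l → proj₁ ∘ off l)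
          (at b b∈C λ l → proj₁ ∘ proj₂ ∘ off l) (at c c∈C λ l → proj₂ ∘ proj₂ ∘ off l))
      where
      off = off₃ pa pb pc
      at : ∀ y → y ∈C C → (∀ l → l ∉ k ∷ j ∷ i ∷ [] → Binary (lookup y l)) → lookup y v ≡ 0L
      at y y∈C y-bin = vanishes-at y x v (Equivalence.to (sd y) y∈C x x∈C) ¬xv (λ l l≢ → x-bin l λ { (here e) → l≢ e }) x0 y-bin
    refute {v} {x} x∈C x-light (binary x-bin xv _) with three-zeros x x-light
    ... | i , j , _ , j∉ , _ , x0 with pivot [] i (λ ()) | pivot (i ∷ []) j j∉
    ...   | a , a∈C , pa | b , b∈C , pb =
      -- The word `x` vanishes at `i` and `j` and is 1 at `v`, so it serves as third pivot, at `v`.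
      -- Being binary, it leaves only two exceptional coordinates: 12 instead of 18.
      cubeW-large j∉ v∉ a∈C b∈C x∈C pa pb (binary x-bin xv λ l → x0 l ∘ there) (begin
        cubeW a b x + 4  ≤⟨ ℕ.+-monoˡ-≤ 4 (cubeW-≤ (j ∷ i ∷ []) a b x off) ⟩
        (n * 4 + 12) + 4 ≡⟨ ℕ.+-assoc (n * 4) 12 4 ⟩
        n * 4 + 16       ≤⟨ ℕ.+-monoʳ-≤ (n * 4) (ℕ.m≤m+n 16 2) ⟩
        n * 4 + 18       ∎)
      where
      open ℕ.≤-Reasoning
      v∉ : v ∉ j ∷ i ∷ []
      v∉ v∈ = contradiction (trans (sym xv) (x0 v (there v∈))) λ ()
      off : ∀ l → l ∉ j ∷ i ∷ [] → Binary (lookup a l) × Binary (lookup b l) × Binary (lookup x l)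
      off l l∉ = pivot-binary a pa l (λ { (here e) → l∉ (there (here e)) }) , pivot-binary b pb l l∉ , x-bin l

  no-heavy-selfDual : 3 ≤ n → ⊥
  no-heavy-selfDual (s≤s (s≤s (s≤s z≤n))) with pivot [] zero (λ ())
  ... | x , x∈C , px = refute x∈C (light {j = suc zero} {suc (suc zero)} (λ { (here ()) }) (λ { (here ()) ; (there (here ())) }) x∈C px) px

-- The lengths to which the contradiction applies.

Bounds : ℕ → ℕ → Set
Bounds n q = 3 ≤ n × 3 * n + 21 ≤ 6 * (2 * q + 2) × 4 * n + 15 ≤ 7 * (2 * q + 2)

bounds? : ∀ n q → Dec (Bounds n q)
bounds? n q = (3 ℕ.≤? n) ×-dec (3 * n + 21 ℕ.≤? 6 * (2 * q + 2)) ×-dec (4 * n + 15 ℕ.≤? 7 * (2 * q + 2))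

-- The residue 2 is the worst case; there the slacks are `3 * p` and `1 + 2 * p`. Quotient 5 is the
-- least that works for every residue: both inequalities fail at length 14.
bounds-large : ∀ r p → r < 3 → Bounds (r + (5 + p) * 3) (5 + p)
bounds-large r p r<3 = ℕ.≤-trans (ℕ.m≤m+n 3 (12 + p * 3)) (ℕ.m≤n+m ((5 + p) * 3) r) , b₁ , b₂
  where
  r≤2 : r ≤ 2
  r≤2 = ℕ.≤-pred r<3
  open ℕ.≤-Reasoning
  b₁ : 3 * (r + (5 + p) * 3) + 21 ≤ 6 * (2 * (5 + p) + 2)
  b₁ = begin
    3 * (r + (5 + p) * 3) + 21 ≤⟨ ℕ.+-monoˡ-≤ 21 (ℕ.*-monoʳ-≤ 3 (ℕ.+-monoˡ-≤ ((5 + p) * 3) r≤2)) ⟩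
    3 * (2 + (5 + p) * 3) + 21 ≤⟨ ℕ.m≤m+n _ (3 * p) ⟩
    3 * (2 + (5 + p) * 3) + 21 + 3 * p ≡⟨ e₁ p ⟩
    6 * (2 * (5 + p) + 2) ∎
    where
    e₁ : ∀ p → 3 * (2 + (5 + p) * 3) + 21 + 3 * p ≡ 6 * (2 * (5 + p) + 2)
    e₁ = solve-∀
  b₂ : 4 * (r + (5 + p) * 3) + 15 ≤ 7 * (2 * (5 + p) + 2)
  b₂ = begin
    4 * (r + (5 + p) * 3) + 15 ≤⟨ ℕ.+-monoˡ-≤ 15 (ℕ.*-monoʳ-≤ 4 (ℕ.+-monoˡ-≤ ((5 + p) * 3) r≤2)) ⟩
    4 * (2 + (5 + p) * 3) + 15 ≤⟨ ℕ.m≤m+n _ (1 + 2 * p) ⟩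
    4 * (2 + (5 + p) * 3) + 15 + (1 + 2 * p) ≡⟨ e₂ p ⟩
    7 * (2 * (5 + p) + 2) ∎
    where
    e₂ : ∀ p → 4 * (2 + (5 + p) * 3) + 15 + (1 + 2 * p) ≡ 7 * (2 * (5 + p) + 2)
    e₂ = solve-∀

exceptions : List ℕ
exceptions = 1 ∷ 2 ∷ 3 ∷ 4 ∷ 5 ∷ 6 ∷ 7 ∷ 8 ∷ 10 ∷ 11 ∷ 14 ∷ []

bounds : ∀ n → n ≥ 1 → n ∉ exceptions → Bounds n (n / 3)
bounds n n≥1 n∉ with n ℕ.<? 15
... | yes n<15 = small n<15 n≥1 n∉
  where
  small : ∀ {n} → n < 15 → n ≥ 1 → n ∉ exceptions → Bounds n (n / 3)
  -- Only the lengths 9, 12 and 13 are left to check here.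
  small = toWitness {a? = ℕ.allUpTo? (λ n → (1 ℕ.≤? n) →-dec ¬? (_∈?_ ℕ._≟_ n exceptions) →-dec bounds? n (n / 3)) 15} tt
... | no n≮15 = subst₂ Bounds (sym (trans (m≡m%n+[m/n]*n n 3) (cong (λ q → n % 3 + q * 3) (sym q≡)))) q≡
                  (bounds-large (n % 3) (n / 3 ∸ 5) (m%n<n n 3))
  where
  q≡ : 5 + (n / 3 ∸ 5) ≡ n / 3
  q≡ = ℕ.m+[n∸m]≡n (/-monoˡ-≤ 3 (ℕ.≮⇒≥ n≮15))

theorem4p14 : ((n : ℕ) → n ∈ (1 ∷ 2 ∷ 3 ∷ 4 ∷ 5 ∷ 6 ∷ 7 ∷ 8 ∷ 10 ∷ 11 ∷ []) →
    ∃ λ (C : LCode n) → Extremal C) ×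
    ((n : ℕ) → n ≥ 1 → n ∉ (1 ∷ 2 ∷ 3 ∷ 4 ∷ 5 ∷ 6 ∷ 7 ∷ 8 ∷ 10 ∷ 11 ∷ 14 ∷ []) →
    ¬ (∃ λ (C : LCode n) → Extremal C))
theorem4p14 = extremal-exists , λ n n≥1 n∉ (C , _ , sd , _ , heavy) →
  let (3≤n , h₁ , h₂) = bounds n n≥1 n∉ in no-heavy-selfDual h₁ h₂ C sd heavy 3≤n
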